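{- $(\mathcal{G},+)$, $(\mathcal{G},\cdot)$, $(\mathcal{G}_0,\cdot)$, $(\mathcal{A},+)$, $(\mathcal{M},\cdot)$, $(\mathcal{I},\cdot)$ and $(\mathcal{I}_0,\cdot)$ are commutative monoids. Moreover, $(\mathcal{G}_0,+)$ is a subsemigroup of $(\mathcal{G},+)$, $(\mathcal{A}_0,+)$ is a subsemigroup of $(\mathcal{A},+)$, $(\mathcal{M}_1,\cdot)$ is a subsemigroup of $(\mathcal{M},\cdot)$, and $(\mathcal{I}_{01},\cdot)$ is a subsemigroup of $(\mathcal{I},\cdot)$ and of $(\mathcal{I}_0,\cdot)$.
   Context: $\mathbb{N}$ is the set of positive integers. Arithmetic functions are functions $\mathbb{N}\to\mathbb{R}$; $+$ and $\cdot$ denote pointwise sum and product. $f$ is additive if $f(xy)=f(x)+f(y)$ for all coprime $x,y\in\mathbb{N}$; $g$ is multiplicative if $g$ is not identically zero and $g(xy)=g(x)g(y)$ for all coprime $x,y\in\mathbb{N}$. (So $f(1)=0$ for additive $f$ and $g(1)=1$ for multiplicative $g$.) In the following sets, the inequalities are required for all $x\in\mathbb{N}$ with $x>1$: $\mathcal{G}=\{f:\mathbb{N}\to\mathbb{R}: f(1)=0,\ f(x)\ge0\}$, $\mathcal{G}_0=\{f\in\mathcal{G}: f(x)>0\}$; $\mathcal{A}=\{f\text{ additive}: f(x)\ge0\}$, $\mathcal{A}_0=\{f\in\mathcal{A}: f(x)>0\}$; $\mathcal{M}=\{g\text{ multiplicative}: g(x)\ge1\}$, $\mathcal{M}_1=\{g\in\mathcal{M}: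 g(x)>1\}$; $\mathcal{I}=\{h\text{ multiplicative}: 0\le h(x)\le1\}$, $\mathcal{I}_0=\{h\in\mathcal{I}: 0<h(x)\le1\}$, $\mathcal{I}_{01}=\{h\in\mathcal{I}: 0<h(x)<1\}$. -}

module Defs where

open import Algebra.Core using (Op₂)
open import Algebra.Structures using (IsSemigroup; IsCommutativeMonoid)
open import Data.Nat.Base as ℕ using (ℕ; NonZero)
import Data.Nat.Properties as ℕ
open import Data.Nat.Coprimality using (Coprime)
open import Data.Product.Base using (∃; ∃-syntax; _×_; _,_; proj₁)
open import Data.Rational.Base as ℚ using (ℚ; 0ℚ; 1ℚ; ½; ∣_∣)
import Data.Rational.Properties as ℚ
open import Data.Rational.Solver using (module +-*-Solver)
open import Function.Base using (_on_)
open import Level using (0ℓ)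
open import Relation.Binary.Core using (Rel)
open import Relation.Binary.PropositionalEquality
  using (_≡_; refl; sym; trans; cong; subst)
open import Relation.Nullary.Negation.Core using (¬_)
open import Relation.Unary using (Pred; _∈_; _⊆_)

------------------------------------------------------------------------
-- The real numbers, as Cauchy sequences of rationals.
--
-- The existential in `IsCauchy` is a Σ-type, so a real carries a modulus
-- of convergence.  Distinct sequences may denote the same real: equality
-- of reals is the relation _≈_ below, never _≡_.

IsCauchy : (ℕ → ℚ) → Set
IsCauchy s = ∀ ε → 0ℚ ℚ.< ε →
  ∃[ N ] ∀ m n → N ℕ.≤ m → N ℕ.≤ n → ∣ s m ℚ.- s n ∣ ℚ.< ε

record ℝ : Set where
  constructor mkℝ
  field
    seq    : ℕ → ℚ
    cauchy : IsCauchy seq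

open ℝ public

infix 4 _≈_ _≤_ _<_

_≈_ : Rel ℝ 0ℓ
x ≈ y = ∀ ε → 0ℚ ℚ.< ε → ∃[ N ] ∀ n → N ℕ.≤ n → ∣ seq x n ℚ.- seq y n ∣ ℚ.< ε

_≤_ : Rel ℝ 0ℓ
x ≤ y = ∀ ε → 0ℚ ℚ.< ε → ∃[ N ] ∀ n → N ℕ.≤ n → seq x n ℚ.≤ seq y n ℚ.+ ε

_<_ : Rel ℝ 0ℓ
x < y = ∃[ ε ] 0ℚ ℚ.< ε × ∃[ N ] ∀ n → N ℕ.≤ n → seq x n ℚ.+ ε ℚ.≤ seq y n

ε/2>0 : ∀ {ε} → 0ℚ ℚ.< ε → 0ℚ ℚ.< ½ ℚ.* ε
ε/2>0 = ℚ.*-monoʳ-<-pos ½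

ε/2+ε/2 : ∀ ε → ½ ℚ.* ε ℚ.+ ½ ℚ.* ε ≡ ε
ε/2+ε/2 ε = trans (sym (ℚ.*-distribʳ-+ ε ½ ½)) (ℚ.*-identityˡ ε)

+-cauchy : ∀ {s t} → IsCauchy s → IsCauchy t → IsCauchy (λ n → s n ℚ.+ t n)
+-cauchy {s} {t} cs ct ε ε>0 =
  let (N₁ , p₁) = cs (½ ℚ.* ε) (ε/2>0 ε>0)
      (N₂ , p₂) = ct (½ ℚ.* ε) (ε/2>0 ε>0)
  in N₁ ℕ.⊔ N₂ , λ m n m≥ n≥ → begin-strict
    ∣ (s m ℚ.+ t m) ℚ.- (s n ℚ.+ t n) ∣
      ≡⟨ cong ∣_∣ (rearrange (s m) (t m) (s n) (t n)) ⟩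
    ∣ (s m ℚ.- s n) ℚ.+ (t m ℚ.- t n) ∣
      ≤⟨ ℚ.∣p+q∣≤∣p∣+∣q∣ (s m ℚ.- s n) (t m ℚ.- t n) ⟩
    ∣ s m ℚ.- s n ∣ ℚ.+ ∣ t m ℚ.- t n ∣
      <⟨ ℚ.+-mono-< (p₁ m n (ℕ.m⊔n≤o⇒m≤o N₁ N₂ m≥) (ℕ.m⊔n≤o⇒m≤o N₁ N₂ n≥))
                    (p₂ m n (ℕ.m⊔n≤o⇒n≤o N₁ N₂ m≥) (ℕ.m⊔n≤o⇒n≤o N₁ N₂ n≥)) ⟩
    ½ ℚ.* ε ℚ.+ ½ ℚ.* ε
      ≡⟨ ε/2+ε/2 ε ⟩
    ε ∎
  where
  open ℚ.≤-Reasoning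
  open +-*-Solver
  rearrange : ∀ a b c d → (a ℚ.+ b) ℚ.- (c ℚ.+ d) ≡ (a ℚ.- c) ℚ.+ (b ℚ.- d)
  rearrange = solve 4 (λ a b c d → (a :+ b) :- (c :+ d) := (a :- c) :+ (b :- d)) refl

eventuallyBounded : ∀ {s} → IsCauchy s →
  ∃[ B ] 0ℚ ℚ.< B × ∃[ N ] ∀ n → N ℕ.≤ n → ∣ s n ∣ ℚ.≤ B
eventuallyBounded {s} cs =
  let (N , p) = cs 1ℚ 0<1
  in 1ℚ ℚ.+ ∣ s N ∣
   , ℚ.+-mono-<-≤ 0<1 (ℚ.0≤∣p∣ (s N))
   , N , λ n n≥ → begin
    ∣ s n ∣                       ≡⟨ cong ∣_∣ (split (s n) (s N)) ⟩
    ∣ (s n ℚ.- s N) ℚ.+ s N ∣     ≤⟨ ℚ.∣p+q∣≤∣p∣+∣q∣ (s n ℚ.- s N) (s N) ⟩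
    ∣ s n ℚ.- s N ∣ ℚ.+ ∣ s N ∣   ≤⟨ ℚ.+-monoˡ-≤ ∣ s N ∣ (ℚ.<⇒≤ (p n N n≥ ℕ.≤-refl)) ⟩
    1ℚ ℚ.+ ∣ s N ∣                ∎
  where
  open ℚ.≤-Reasoning
  open +-*-Solver
  0<1 : 0ℚ ℚ.< 1ℚ
  0<1 = ℚ.positive⁻¹ 1ℚ
  split : ∀ a b → a ≡ (a ℚ.- b) ℚ.+ b
  split = solve 2 (λ a b → a := (a :- b) :+ b) refl

shrink : ∀ B ε → 0ℚ ℚ.< B → 0ℚ ℚ.< ε → ∃[ δ ] 0ℚ ℚ.< δ × B ℚ.* δ ≡ ε
shrink B ε B>0 ε>0 = (1/B ℚ.* ε) , δ>0 , eq
  where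
  instance
    pos : ℚ.Positive B
    pos = ℚ.positive B>0
    nz : ℚ.NonZero B
    nz = ℚ.pos⇒nonZero B
  1/B = ℚ.1/ B
  instance
    1/pos : ℚ.Positive 1/B
    1/pos = ℚ.1/pos⇒pos B
  δ>0 : 0ℚ ℚ.< 1/B ℚ.* ε
  δ>0 = subst (ℚ._< 1/B ℚ.* ε) (ℚ.*-zeroʳ 1/B) (ℚ.*-monoʳ-<-pos 1/B ε>0)
  eq : B ℚ.* (1/B ℚ.* ε) ≡ ε
  eq = trans (sym (ℚ.*-assoc B 1/B ε))
             (trans (cong (ℚ._* ε) (ℚ.*-inverseʳ B)) (ℚ.*-identityˡ ε))

*-mono-abs : ∀ {a b c d} → ∣ a ∣ ℚ.≤ b → ∣ c ∣ ℚ.< d → 0ℚ ℚ.< b →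
  ∣ a ℚ.* c ∣ ℚ.< b ℚ.* d
*-mono-abs {a} {b} {c} {d} a≤b c<d b>0 = begin-strict
  ∣ a ℚ.* c ∣       ≡⟨ ℚ.∣p*q∣≡∣p∣*∣q∣ a c ⟩
  ∣ a ∣ ℚ.* ∣ c ∣   ≤⟨ ℚ.*-monoʳ-≤-nonNeg ∣ c ∣ {{ℚ.∣-∣-nonNeg c}} a≤b ⟩
  b ℚ.* ∣ c ∣       <⟨ ℚ.*-monoʳ-<-pos b {{ℚ.positive b>0}} c<d ⟩
  b ℚ.* d           ∎
  where open ℚ.≤-Reasoning

*-cauchy : ∀ {s t} → IsCauchy s → IsCauchy t → IsCauchy (λ n → s n ℚ.* t n)
*-cauchy {s} {t} cs ct ε ε>0 =
  let (B , B>0 , N₁ , b) = eventuallyBounded cs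
      (C , C>0 , N₂ , c) = eventuallyBounded ct
      (δ , δ>0 , eq)     = shrink (B ℚ.+ C) ε (ℚ.+-mono-< B>0 C>0) ε>0
      (N₃ , p)           = cs δ δ>0
      (N₄ , q)           = ct δ δ>0
      N₁₂ = N₁ ℕ.⊔ N₂
      N₃₄ = N₃ ℕ.⊔ N₄
  in N₁₂ ℕ.⊔ N₃₄ , λ m n m≥ n≥ → begin-strict
    ∣ s m ℚ.* t m ℚ.- s n ℚ.* t n ∣
      ≡⟨ cong ∣_∣ (rearrange (s m) (t m) (s n) (t n)) ⟩
    ∣ s m ℚ.* (t m ℚ.- t n) ℚ.+ t n ℚ.* (s m ℚ.- s n) ∣
      ≤⟨ ℚ.∣p+q∣≤∣p∣+∣q∣ (s m ℚ.* (t m ℚ.- t n)) (t n ℚ.* (s m ℚ.- s n)) ⟩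
    ∣ s m ℚ.* (t m ℚ.- t n) ∣ ℚ.+ ∣ t n ℚ.* (s m ℚ.- s n) ∣
      <⟨ ℚ.+-mono-<
           (*-mono-abs {s m} (b m (ℕ.m⊔n≤o⇒m≤o N₁ N₂ (ℕ.m⊔n≤o⇒m≤o N₁₂ N₃₄ m≥)))
                       (q m n (ℕ.m⊔n≤o⇒n≤o N₃ N₄ (ℕ.m⊔n≤o⇒n≤o N₁₂ N₃₄ m≥)) (ℕ.m⊔n≤o⇒n≤o N₃ N₄ (ℕ.m⊔n≤o⇒n≤o N₁₂ N₃₄ n≥))) B>0)
           (*-mono-abs {t n} (c n (ℕ.m⊔n≤o⇒n≤o N₁ N₂ (ℕ.m⊔n≤o⇒m≤o N₁₂ N₃₄ n≥)))
                       (p m n (ℕ.m⊔n≤o⇒m≤o N₃ N₄ (ℕ.m⊔n≤o⇒n≤o N₁₂ N₃₄ m≥)) (ℕ.m⊔n≤o⇒m≤o N₃ N₄ (ℕ.m⊔n≤o⇒n≤o N₁₂ N₃₄ n≥))) C>0) ⟩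
    B ℚ.* δ ℚ.+ C ℚ.* δ
      ≡⟨ sym (ℚ.*-distribʳ-+ δ B C) ⟩
    (B ℚ.+ C) ℚ.* δ
      ≡⟨ eq ⟩
    ε ∎
  where
  open ℚ.≤-Reasoning
  open +-*-Solver
  rearrange : ∀ a b c d →
    a ℚ.* b ℚ.- c ℚ.* d ≡ a ℚ.* (b ℚ.- d) ℚ.+ d ℚ.* (a ℚ.- c)
  rearrange = solve 4 (λ a b c d →
    a :* b :- c :* d := a :* (b :- d) :+ d :* (a :- c)) refl

infixl 6 _+_
infixl 7 _*_

_+_ : Op₂ ℝ
x + y = mkℝ (λ n → seq x n ℚ.+ seq y n) (+-cauchy {seq x} {seq y} (cauchy x) (cauchy y))

_*_ : Op₂ ℝ
x * y = mkℝ (λ n → seq x n ℚ.* seq y n) (*-cauchy {seq x} {seq y} (cauchy x) (cauchy y))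

fromℚ : ℚ → ℝ
fromℚ q = mkℝ (λ _ → q) λ ε ε>0 →
  0 , λ _ _ _ _ → subst (ℚ._< ε) (sym (cong ∣_∣ (ℚ.+-inverseʳ q))) ε>0

0ℝ 1ℝ : ℝ
0ℝ = fromℚ 0ℚ
1ℝ = fromℚ 1ℚ

------------------------------------------------------------------------
-- Arithmetic functions.  The domain is the positive integers; positivity
-- is an irrelevant argument, so the value cannot depend on its proof.

ArithFun : Set
ArithFun = (n : ℕ) → .{{NonZero n}} → ℝ

infix 4 _≋_
infixl 6 _⊕_
infixl 7 _⊙_

_≋_ : Rel ArithFun 0ℓ
f ≋ g = ∀ n .{{_ : NonZero n}} → f n ≈ g n

_⊕_ : Op₂ ArithFun
(f ⊕ g) n = f n + g n

_⊙_ : Op₂ ArithFun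
(f ⊙ g) n = f n * g n

Additive : Pred ArithFun 0ℓ
Additive f = ∀ x y .{{_ : NonZero x}} .{{_ : NonZero y}} → Coprime x y →
  f (x ℕ.* y) {{ℕ.m*n≢0 x y}} ≈ f x + f y

Multiplicative : Pred ArithFun 0ℓ
Multiplicative g =
  ¬ (∀ x .{{_ : NonZero x}} → g x ≈ 0ℝ) ×
  (∀ x y .{{_ : NonZero x}} .{{_ : NonZero y}} → Coprime x y →
    g (x ℕ.* y) {{ℕ.m*n≢0 x y}} ≈ g x * g y)

ForAll>1 : Pred ℝ 0ℓ → Pred ArithFun 0ℓ
ForAll>1 P f = ∀ x .{{_ : NonZero x}} → 1 ℕ.< x → P (f x)

𝒢 𝒢₀ 𝒜 𝒜₀ ℳ ℳ₁ ℐ ℐ₀ ℐ₀₁ : Pred ArithFun 0ℓ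
𝒢   f = f 1 ≈ 0ℝ × ForAll>1 (λ r → 0ℝ ≤ r) f
𝒢₀  f = f ∈ 𝒢 × ForAll>1 (λ r → 0ℝ < r) f
𝒜   f = Additive f × ForAll>1 (λ r → 0ℝ ≤ r) f
𝒜₀  f = f ∈ 𝒜 × ForAll>1 (λ r → 0ℝ < r) f
ℳ   g = Multiplicative g × ForAll>1 (λ r → 1ℝ ≤ r) g
ℳ₁  g = g ∈ ℳ × ForAll>1 (λ r → 1ℝ < r) g
ℐ   h = Multiplicative h × ForAll>1 (λ r → 0ℝ ≤ r × r ≤ 1ℝ) h
ℐ₀  h = h ∈ ℐ × ForAll>1 (λ r → 0ℝ < r × r ≤ 1ℝ) h
ℐ₀₁ h = h ∈ ℐ × ForAll>1 (λ r → 0ℝ < r × r < 1ℝ) h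

------------------------------------------------------------------------
-- Sets of arithmetic functions as algebraic structures.  The set {f | P f}
-- is the type ∃ P, with equality that of the underlying functions.

Closed : Pred ArithFun 0ℓ → Op₂ ArithFun → Set
Closed P _∙_ = ∀ {f g} → f ∈ P → g ∈ P → (f ∙ g) ∈ P

restrict : ∀ {P _∙_} → Closed P _∙_ → Op₂ (∃ P)
restrict {_∙_ = _∙_} closed (f , f∈P) (g , g∈P) = (f ∙ g) , closed f∈P g∈P

record IsSemigroupOn (P : Pred ArithFun 0ℓ) (_∙_ : Op₂ ArithFun) : Set where
  field
    closed      : Closed P _∙_
    isSemigroup : IsSemigroup {A = ∃ P} (_≋_ on proj₁) (restrict {P} {_∙_} closed)

-- The identity element is existentially quantified and need not be an
-- identity for _∙_ on all arithmetic functions.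
record IsCommutativeMonoidOn (P : Pred ArithFun 0ℓ) (_∙_ : Op₂ ArithFun) : Set where
  field
    closed              : Closed P _∙_
    ε                   : ∃ P
    isCommutativeMonoid : IsCommutativeMonoid {A = ∃ P} (_≋_ on proj₁) (restrict {P} {_∙_} closed) ε

-- (P , ∙) is a subsemigroup of the semigroup (Q , ∙): a nonempty subset of Q
-- closed under ∙.
record IsSubsemigroupOf (P Q : Pred ArithFun 0ℓ) (_∙_ : Op₂ ArithFun) : Set where
  field
    ambient  : IsSemigroupOn Q _∙_
    included : P ⊆ Q
    nonempty : ∃ P
    closed   : Closed P _∙_

{-# OPTIONS --safe #-}
-- Everything is pointwise in the reals, so the work is the ordered ring
-- structure of ℝ up to _≈_.  Three points are not formal.  A product of
-- multiplicative functions must again not vanish identically: g(1) is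
-- idempotent, an idempotent real is 0 or 1, and g(1) ≈ 0 would force g ≈ 0,
-- hence g(1) ≈ 1.  The monoids (𝒢,·) and (𝒢₀,·) have as identity the function
-- that is 0 at 1 and 1 elsewhere.  The subsemigroups are nonempty because
-- Ω(n), 2^Ω(n) and 2^-Ω(n) lie in them, where Ω counts prime factors.
module Submission where

open import Defs
open import Algebra.Bundles using (CommutativeMonoid)
open import Algebra.Core using (Op₂)
import Algebra.Properties.CommutativeSemigroup as CommutativeSemigroupProperties
import Algebra.Properties.Monoid.Mult.TCOptimised as MonoidMult
open import Algebra.Structures using (IsCommutativeMonoid)
open import Data.List.Base using ([]; _∷_; _++_; length)
open import Data.List.Properties using (length-++)
open import Data.List.Relation.Binary.Permutation.Propositional.Properties using (↭-length)
open import Data.List.Relation.Unary.All.Properties using (++⁺)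
open import Data.Nat.Base as ℕ using (ℕ; zero; suc; NonZero)
open import Data.Nat.Coprimality using (Coprime; 1-coprimeTo)
open import Data.Nat.ListAction.Properties using (product-++)
open import Data.Nat.Primality.Factorisation
  using (PrimeFactorisation; factors; factorise; factorisationUnique)
import Data.Nat.Properties as ℕ
open import Data.Product.Base using (∃; ∃-syntax; _×_; _,_; proj₁; proj₂)
open import Data.Rational.Base as ℚ using (ℚ; 0ℚ; 1ℚ; ½; ∣_∣)
import Data.Rational.Properties as ℚ
open import Data.Rational.Solver using (module +-*-Solver)
open import Data.Sum.Base using (_⊎_; inj₁; inj₂; [_,_]′)
open import Function.Base using (id; _∘_)
open import Level using (0ℓ)
open import Relation.Binary.Bundles using (Setoid)
open import Relation.Binary.PropositionalEquality
  using (_≡_; refl; sym; trans; cong; cong₂; subst; subst₂)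
import Relation.Binary.Reasoning.Setoid as SetoidReasoning
open import Relation.Nullary.Negation.Core using (¬_; contradiction)
open import Relation.Unary using (Pred; _∈_; _⊆_)

open +-*-Solver

-- Rational estimates and properties that hold from some index on.

p≤∣p∣ : ∀ p → p ℚ.≤ ∣ p ∣
p≤∣p∣ p = [ (λ 0≤p → ℚ.≤-reflexive (sym (ℚ.0≤p⇒∣p∣≡p 0≤p)))
          , (λ p≤0 → ℚ.≤-trans p≤0 (ℚ.0≤∣p∣ p)) ]′ (ℚ.≤-total 0ℚ p)

0≤p*q : ∀ {p q} → 0ℚ ℚ.≤ p → 0ℚ ℚ.≤ q → 0ℚ ℚ.≤ p ℚ.* q
0≤p*q {p} {q} 0≤p 0≤q =
  ℚ.nonNegative⁻¹ (p ℚ.* q)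
    {{ℚ.nonNeg*nonNeg⇒nonNeg p {{ℚ.nonNegative 0≤p}} q {{ℚ.nonNegative 0≤q}}}}

-- The triangle inequality with ε split into halves. The sum is a separate `r`, so that a difference
-- of any shape can be supplied together with a ring identity that splits it.
∣p+q∣<ε : ∀ {p q r ε} → r ≡ p ℚ.+ q → ∣ p ∣ ℚ.< ½ ℚ.* ε → ∣ q ∣ ℚ.< ½ ℚ.* ε → ∣ r ∣ ℚ.< ε
∣p+q∣<ε {p} {q} {r} {ε} r≡p+q p< q< = begin-strict
  ∣ r ∣                    ≡⟨ cong ∣_∣ r≡p+q ⟩
  ∣ p ℚ.+ q ∣              ≤⟨ ℚ.∣p+q∣≤∣p∣+∣q∣ p q ⟩
  ∣ p ∣ ℚ.+ ∣ q ∣          <⟨ ℚ.+-mono-< p< q< ⟩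
  ½ ℚ.* ε ℚ.+ ½ ℚ.* ε      ≡⟨ ε/2+ε/2 ε ⟩
  ε                        ∎
  where open ℚ.≤-Reasoning

-- The tails of `_≈_`, `_≤_` and `_<_` all have this shape, so an estimate between rationals at a
-- single index lifts to a relation between reals.
Eventually : Pred (Pred ℕ 0ℓ) 0ℓ
Eventually P = ∃[ N ] ∀ n → N ℕ.≤ n → P n

always : ∀ {P : Pred ℕ 0ℓ} → (∀ n → P n) → Eventually P
always p = 0 , λ n _ → p n

eventually-map : ∀ {P Q : Pred ℕ 0ℓ} → (∀ n → P n → Q n) → Eventually P → Eventually Q
eventually-map f (N , p) = N , λ n N≤n → f n (p n N≤n)

eventually-zipWith : ∀ {P Q R : Pred ℕ 0ℓ} → (∀ n → P n → Q n → R n) →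
  Eventually P → Eventually Q → Eventually R
eventually-zipWith f (M , p) (N , q) =
  M ℕ.⊔ N , λ n n≥ → f n (p n (ℕ.m⊔n≤o⇒m≤o M N n≥)) (q n (ℕ.m⊔n≤o⇒n≤o M N n≥))

eventually-witness : ∀ {P : Pred ℕ 0ℓ} → Eventually P → ∃ P
eventually-witness (N , p) = N , p N ℕ.≤-refl

-- The commutative semiring of reals

-- Carries rational ring identities over to the reals term by term. Implicit reals are mostly
-- supplied by hand, here and below: the unfolded relations mention only the sequences, which do not
-- determine the Cauchy proofs.
≗⇒≈ : ∀ {x y} → (∀ n → seq x n ≡ seq y n) → x ≈ y
≗⇒≈ {x} {y} x≗y ε ε>0 = always λ n → subst (ℚ._< ε) (sym (begin
  ∣ seq x n ℚ.- seq y n ∣   ≡⟨ cong (λ p → ∣ p ℚ.- seq y n ∣) (x≗y n) ⟩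
  ∣ seq y n ℚ.- seq y n ∣   ≡⟨ cong ∣_∣ (ℚ.+-inverseʳ (seq y n)) ⟩
  0ℚ                        ∎)) ε>0
  where open Relation.Binary.PropositionalEquality.≡-Reasoning

≈-refl : ∀ {x} → x ≈ x
≈-refl {x} = ≗⇒≈ {x} {x} λ _ → refl

≈-sym : ∀ {x y} → x ≈ y → y ≈ x
≈-sym {x} {y} x≈y ε ε>0 =
  eventually-map (λ n → subst (ℚ._< ε) (∣p-q∣≡∣q-p∣ (seq x n) (seq y n))) (x≈y ε ε>0)
  where
  ∣p-q∣≡∣q-p∣ : ∀ p q → ∣ p ℚ.- q ∣ ≡ ∣ q ℚ.- p ∣
  ∣p-q∣≡∣q-p∣ p q = trans (sym (ℚ.∣-p∣≡∣p∣ (p ℚ.- q)))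
    (cong ∣_∣ (solve 2 (λ p q → :- (p :- q) := q :- p) refl p q))

≈-trans : ∀ {x y z} → x ≈ y → y ≈ z → x ≈ z
≈-trans {x} {y} {z} x≈y y≈z ε ε>0 =
  eventually-zipWith (λ n → ∣p+q∣<ε (split (seq x n) (seq y n) (seq z n)))
    (x≈y _ (ε/2>0 ε>0)) (y≈z _ (ε/2>0 ε>0))
  where
  split : ∀ p q r → p ℚ.- r ≡ (p ℚ.- q) ℚ.+ (q ℚ.- r)
  split = solve 3 (λ p q r → p :- r := (p :- q) :+ (q :- r)) refl

≈-setoid : Setoid 0ℓ 0ℓ
≈-setoid = record
  { Carrier = ℝ
  ; _≈_ = _≈_
  ; isEquivalence = record
    { refl  = λ {x} → ≈-refl {x}
    ; sym   = λ {x} {y} → ≈-sym {x} {y}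
    ; trans = λ {x} {y} {z} → ≈-trans {x} {y} {z}
    }
  }

+-cong : ∀ {x y u v} → x ≈ y → u ≈ v → x + u ≈ y + v
+-cong {x} {y} {u} {v} x≈y u≈v ε ε>0 =
  eventually-zipWith (λ n → ∣p+q∣<ε (split (seq x n) (seq y n) (seq u n) (seq v n)))
    (x≈y _ (ε/2>0 ε>0)) (u≈v _ (ε/2>0 ε>0))
  where
  split : ∀ p q r s → (p ℚ.+ r) ℚ.- (q ℚ.+ s) ≡ (p ℚ.- q) ℚ.+ (r ℚ.- s)
  split = solve 4 (λ p q r s → (p :+ r) :- (q :+ s) := (p :- q) :+ (r :- s)) refl

*-comm : ∀ x y → x * y ≈ y * x
*-comm x y = ≗⇒≈ {x * y} {y * x} λ n → ℚ.*-comm (seq x n) (seq y n)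

-- Multiplication by `z` scales errors by at most an eventual bound B of its absolute value, so
-- closeness within δ suffices when B δ ≡ ε.
*-congˡ : ∀ {x y z} → x ≈ y → z * x ≈ z * y
*-congˡ {x} {y} {z} x≈y ε ε>0 =
  let (B , B>0 , bounded) = eventuallyBounded (cauchy z)
      (δ , δ>0 , Bδ≡ε)    = shrink B ε B>0 ε>0
  in eventually-zipWith
       (λ n ∣z∣≤B ∣x-y∣<δ → subst₂ ℚ._<_
         (cong ∣_∣ (distrib (seq x n) (seq y n) (seq z n))) Bδ≡ε
         (*-mono-abs {seq z n} ∣z∣≤B ∣x-y∣<δ B>0))
       bounded (x≈y δ δ>0)
  where
  distrib : ∀ p q r → r ℚ.* (p ℚ.- q) ≡ r ℚ.* p ℚ.- r ℚ.* q
  distrib = solve 3 (λ p q r → r :* (p :- q) := r :* p :- r :* q) refl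

*-cong : ∀ {x y u v} → x ≈ y → u ≈ v → x * u ≈ y * v
*-cong {x} {y} {u} {v} x≈y u≈v = begin
  x * u   ≈⟨ *-congˡ {u} {v} {x} u≈v ⟩
  x * v   ≈⟨ *-comm x v ⟩
  v * x   ≈⟨ *-congˡ {x} {y} {v} x≈y ⟩
  v * y   ≈⟨ *-comm v y ⟩
  y * v   ∎
  where open SetoidReasoning ≈-setoid

*-identityˡ : ∀ x → 1ℝ * x ≈ x
*-identityˡ x = ≗⇒≈ {1ℝ * x} {x} λ n → ℚ.*-identityˡ (seq x n)

*-zeroˡ : ∀ x → 0ℝ * x ≈ 0ℝ
*-zeroˡ x = ≗⇒≈ {0ℝ * x} {0ℝ} λ n → ℚ.*-zeroˡ (seq x n)

+-0-isCommutativeMonoid : IsCommutativeMonoid _≈_ _+_ 0ℝ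
+-0-isCommutativeMonoid = record
  { isMonoid = record
    { isSemigroup = record
      { isMagma = record
        { isEquivalence = Setoid.isEquivalence ≈-setoid
        ; ∙-cong = λ {x} {y} {u} {v} → +-cong {x} {y} {u} {v}
        }
      ; assoc = λ x y z → ≗⇒≈ {(x + y) + z} {x + (y + z)}
          λ n → ℚ.+-assoc (seq x n) (seq y n) (seq z n)
      }
    ; identity = (λ x → ≗⇒≈ {0ℝ + x} {x} λ n → ℚ.+-identityˡ (seq x n))
               , (λ x → ≗⇒≈ {x + 0ℝ} {x} λ n → ℚ.+-identityʳ (seq x n))
    }
  ; comm = λ x y → ≗⇒≈ {x + y} {y + x} λ n → ℚ.+-comm (seq x n) (seq y n)
  }

*-1-isCommutativeMonoid : IsCommutativeMonoid _≈_ _*_ 1ℝ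
*-1-isCommutativeMonoid = record
  { isMonoid = record
    { isSemigroup = record
      { isMagma = record
        { isEquivalence = Setoid.isEquivalence ≈-setoid
        ; ∙-cong = λ {x} {y} {u} {v} → *-cong {x} {y} {u} {v}
        }
      ; assoc = λ x y z → ≗⇒≈ {(x * y) * z} {x * (y * z)}
          λ n → ℚ.*-assoc (seq x n) (seq y n) (seq z n)
      }
    ; identity = *-identityˡ
               , (λ x → ≗⇒≈ {x * 1ℝ} {x} λ n → ℚ.*-identityʳ (seq x n))
    }
  ; comm = *-comm
  }

-- Order

≈⇒≤ : ∀ {x y} → x ≈ y → x ≤ y
≈⇒≤ {x} {y} x≈y ε ε>0 = eventually-map (λ n ∣x-y∣<ε → begin
  seq x n                               ≡⟨ split (seq x n) (seq y n) ⟩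
  seq y n ℚ.+ (seq x n ℚ.- seq y n)     ≤⟨ ℚ.+-monoʳ-≤ (seq y n) (p≤∣p∣ _) ⟩
  seq y n ℚ.+ ∣ seq x n ℚ.- seq y n ∣   ≤⟨ ℚ.+-monoʳ-≤ (seq y n) (ℚ.<⇒≤ ∣x-y∣<ε) ⟩
  seq y n ℚ.+ ε                         ∎) (x≈y ε ε>0)
  where
  open ℚ.≤-Reasoning
  split : ∀ p q → p ≡ q ℚ.+ (p ℚ.- q)
  split = solve 2 (λ p q → p := q :+ (p :- q)) refl

≤-trans : ∀ {x y z} → x ≤ y → y ≤ z → x ≤ z
≤-trans {x} {y} {z} x≤y y≤z ε ε>0 = eventually-zipWith (λ n x≤ y≤ → begin
  seq x n                                ≤⟨ x≤ ⟩
  seq y n ℚ.+ ½ ℚ.* ε                    ≤⟨ ℚ.+-monoˡ-≤ (½ ℚ.* ε) y≤ ⟩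
  (seq z n ℚ.+ ½ ℚ.* ε) ℚ.+ ½ ℚ.* ε      ≡⟨ ℚ.+-assoc (seq z n) _ _ ⟩
  seq z n ℚ.+ (½ ℚ.* ε ℚ.+ ½ ℚ.* ε)      ≡⟨ cong (seq z n ℚ.+_) (ε/2+ε/2 ε) ⟩
  seq z n ℚ.+ ε                          ∎) (x≤y _ (ε/2>0 ε>0)) (y≤z _ (ε/2>0 ε>0))
  where open ℚ.≤-Reasoning

<⇒≤ : ∀ {x y} → x < y → x ≤ y
<⇒≤ {x} {y} (δ , δ>0 , x+δ≤y) ε ε>0 = eventually-map (λ n x+δ≤ → begin
  seq x n         ≡⟨ sym (ℚ.+-identityʳ (seq x n)) ⟩
  seq x n ℚ.+ 0ℚ  ≤⟨ ℚ.+-monoʳ-≤ (seq x n) (ℚ.<⇒≤ δ>0) ⟩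
  seq x n ℚ.+ δ   ≤⟨ x+δ≤ ⟩
  seq y n         ≡⟨ sym (ℚ.+-identityʳ (seq y n)) ⟩
  seq y n ℚ.+ 0ℚ  ≤⟨ ℚ.+-monoʳ-≤ (seq y n) (ℚ.<⇒≤ ε>0) ⟩
  seq y n ℚ.+ ε   ∎) x+δ≤y
  where open ℚ.≤-Reasoning

<-≤-trans : ∀ {x y z} → x < y → y ≤ z → x < z
<-≤-trans {x} {y} {z} (ε , ε>0 , x+ε≤y) y≤z =
  -- Half of the gap ε absorbs the slack allowed by `y≤z`; the other half remains as the new gap.
  ½ ℚ.* ε , ε/2>0 ε>0 , eventually-zipWith (λ n x+ε≤ y≤ → begin
    seq x n ℚ.+ ½ ℚ.* ε                     ≡⟨ split (seq x n) ε ⟩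
    (seq x n ℚ.+ ε) ℚ.- ½ ℚ.* ε             ≤⟨ ℚ.+-monoˡ-≤ (ℚ.- (½ ℚ.* ε)) (ℚ.≤-trans x+ε≤ y≤) ⟩
    (seq z n ℚ.+ ½ ℚ.* ε) ℚ.- ½ ℚ.* ε       ≡⟨ cancel (seq z n) (½ ℚ.* ε) ⟩
    seq z n                                 ∎) x+ε≤y (y≤z _ (ε/2>0 ε>0))
  where
  open ℚ.≤-Reasoning
  split : ∀ p ε → p ℚ.+ ½ ℚ.* ε ≡ (p ℚ.+ ε) ℚ.- ½ ℚ.* ε
  split = solve 2 (λ p ε → p :+ con ½ :* ε := (p :+ ε) :- con ½ :* ε) refl
  cancel : ∀ p q → (p ℚ.+ q) ℚ.- q ≡ p
  cancel = solve 2 (λ p q → (p :+ q) :- q := p) refl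

≤-<-trans : ∀ {x y z} → x ≤ y → y < z → x < z
≤-<-trans {x} {y} {z} x≤y (ε , ε>0 , y+ε≤z) =
  ½ ℚ.* ε , ε/2>0 ε>0 , eventually-zipWith (λ n x≤ y+ε≤ → begin
    seq x n ℚ.+ ½ ℚ.* ε                     ≤⟨ ℚ.+-monoˡ-≤ (½ ℚ.* ε) x≤ ⟩
    (seq y n ℚ.+ ½ ℚ.* ε) ℚ.+ ½ ℚ.* ε       ≡⟨ ℚ.+-assoc (seq y n) _ _ ⟩
    seq y n ℚ.+ (½ ℚ.* ε ℚ.+ ½ ℚ.* ε)       ≡⟨ cong (seq y n ℚ.+_) (ε/2+ε/2 ε) ⟩
    seq y n ℚ.+ ε                           ≤⟨ y+ε≤ ⟩
    seq z n                                 ∎) (x≤y _ (ε/2>0 ε>0)) y+ε≤z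
  where open ℚ.≤-Reasoning

-- Otherwise 0 < x ≤ 0, and the gap of 0 < 0 would be a positive rational that is at most 0 at some
-- index.
0<x⇒x≉0 : ∀ {x} → 0ℝ < x → ¬ (x ≈ 0ℝ)
0<x⇒x≉0 {x} 0<x x≈0 =
  let (ε , ε>0 , 0+ε≤0) = <-≤-trans {0ℝ} {x} {0ℝ} 0<x (≈⇒≤ {x} {0ℝ} x≈0)
      (_ , ε≤0)         = eventually-witness 0+ε≤0
  in ℚ.<-irrefl refl (ℚ.<-≤-trans ε>0 (subst (ℚ._≤ 0ℚ) (ℚ.+-identityˡ ε) ε≤0))

fromℚ-mono-< : ∀ {p q} → p ℚ.< q → fromℚ p < fromℚ q
fromℚ-mono-< {p} {q} p<q =
  q ℚ.- p
  , subst (ℚ._< q ℚ.- p) (ℚ.+-inverseʳ p) (ℚ.+-monoˡ-< (ℚ.- p) p<q)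
  , always λ _ → ℚ.≤-reflexive (solve 2 (λ p q → p :+ (q :- p) := q) refl p q)

0<1 : 0ℝ < 1ℝ
0<1 = fromℚ-mono-< (ℚ.positive⁻¹ 1ℚ)

+-nonneg : ∀ {x y} → 0ℝ ≤ x → 0ℝ ≤ y → 0ℝ ≤ x + y
+-nonneg {x} {y} 0≤x 0≤y ε ε>0 = eventually-zipWith (λ n x≥ y≥ → begin
  0ℚ                                              ≤⟨ ℚ.+-mono-≤ x≥ y≥ ⟩
  (seq x n ℚ.+ ½ ℚ.* ε) ℚ.+ (seq y n ℚ.+ ½ ℚ.* ε) ≡⟨ regroup (seq x n) (seq y n) (½ ℚ.* ε) ⟩
  (seq x n ℚ.+ seq y n) ℚ.+ (½ ℚ.* ε ℚ.+ ½ ℚ.* ε) ≡⟨ cong (seq x n ℚ.+ seq y n ℚ.+_) (ε/2+ε/2 ε) ⟩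
  (seq x n ℚ.+ seq y n) ℚ.+ ε                     ∎) (0≤x _ (ε/2>0 ε>0)) (0≤y _ (ε/2>0 ε>0))
  where
  open ℚ.≤-Reasoning
  regroup : ∀ p q r → (p ℚ.+ r) ℚ.+ (q ℚ.+ r) ≡ (p ℚ.+ q) ℚ.+ (r ℚ.+ r)
  regroup = solve 3 (λ p q r → (p :+ r) :+ (q :+ r) := (p :+ q) :+ (r :+ r)) refl

+-pos : ∀ {x y} → 0ℝ < x → 0ℝ < y → 0ℝ < x + y
+-pos {x} {y} (δ , δ>0 , x≥) (η , η>0 , y≥) =
  δ ℚ.+ η , ℚ.+-mono-< δ>0 η>0 , eventually-zipWith (λ n x≥δ y≥η →
    subst (ℚ._≤ seq x n ℚ.+ seq y n)
      (solve 2 (λ δ η → (con 0ℚ :+ δ) :+ (con 0ℚ :+ η) := con 0ℚ :+ (δ :+ η)) refl δ η)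
      (ℚ.+-mono-≤ x≥δ y≥η)) x≥ y≥

-- First choose δ with B δ ≡ ½ ε, then η with (C + δ) η ≡ ½ ε; expanding
-- 0 ≤ (x + η) (y + δ) then leaves an error of at most ε.
*-nonneg : ∀ {x y} → 0ℝ ≤ x → 0ℝ ≤ y → 0ℝ ≤ x * y
*-nonneg {x} {y} 0≤x 0≤y ε ε>0 =
  let (B , B>0 , x≤B)    = eventuallyBounded (cauchy x)
      (C , C>0 , y≤C)    = eventuallyBounded (cauchy y)
      (δ , δ>0 , Bδ)     = shrink B (½ ℚ.* ε) B>0 (ε/2>0 ε>0)
      (η , η>0 , [C+δ]η) = shrink (C ℚ.+ δ) (½ ℚ.* ε) (ℚ.+-mono-< C>0 δ>0) (ε/2>0 ε>0)
  in eventually-zipWith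
       (λ n (∣x∣≤B , ∣y∣≤C) (x≥ , y≥) → estimate (seq x n) (seq y n)
         (ℚ.<⇒≤ δ>0) (ℚ.<⇒≤ η>0) Bδ [C+δ]η
         (ℚ.≤-trans (p≤∣p∣ _) ∣x∣≤B) (ℚ.≤-trans (p≤∣p∣ _) ∣y∣≤C) x≥ y≥)
       (eventually-zipWith (λ _ → _,_) x≤B y≤C)
       (eventually-zipWith (λ _ → _,_) (0≤x η η>0) (0≤y δ δ>0))
  where
  open ℚ.≤-Reasoning
  expand : ∀ a b δ η →
    (a ℚ.+ η) ℚ.* (b ℚ.+ δ) ≡ a ℚ.* b ℚ.+ (a ℚ.* δ ℚ.+ (b ℚ.+ δ) ℚ.* η)
  expand = solve 4 (λ a b δ η →
    (a :+ η) :* (b :+ δ) := a :* b :+ (a :* δ :+ (b :+ δ) :* η)) refl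
  estimate : ∀ a b {δ η B C} → 0ℚ ℚ.≤ δ → 0ℚ ℚ.≤ η →
    B ℚ.* δ ≡ ½ ℚ.* ε → (C ℚ.+ δ) ℚ.* η ≡ ½ ℚ.* ε → a ℚ.≤ B → b ℚ.≤ C →
    0ℚ ℚ.≤ a ℚ.+ η → 0ℚ ℚ.≤ b ℚ.+ δ → 0ℚ ℚ.≤ a ℚ.* b ℚ.+ ε
  estimate a b {δ} {η} {B} {C} 0≤δ 0≤η Bδ [C+δ]η a≤B b≤C a≥ b≥ = begin
    0ℚ
      ≤⟨ 0≤p*q a≥ b≥ ⟩
    (a ℚ.+ η) ℚ.* (b ℚ.+ δ)
      ≡⟨ expand a b δ η ⟩
    a ℚ.* b ℚ.+ (a ℚ.* δ ℚ.+ (b ℚ.+ δ) ℚ.* η)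
      ≤⟨ ℚ.+-monoʳ-≤ (a ℚ.* b) (ℚ.+-mono-≤
           (ℚ.*-monoʳ-≤-nonNeg δ {{ℚ.nonNegative 0≤δ}} a≤B)
           (ℚ.*-monoʳ-≤-nonNeg η {{ℚ.nonNegative 0≤η}} (ℚ.+-monoˡ-≤ δ b≤C))) ⟩
    a ℚ.* b ℚ.+ (B ℚ.* δ ℚ.+ (C ℚ.+ δ) ℚ.* η)
      ≡⟨ cong (a ℚ.* b ℚ.+_) (trans (cong₂ ℚ._+_ Bδ [C+δ]η) (ε/2+ε/2 ε)) ⟩
    a ℚ.* b ℚ.+ ε
      ∎

*-pos : ∀ {x y} → 0ℝ < x → 0ℝ < y → 0ℝ < x * y
*-pos {x} {y} (δ , δ>0 , x≥) (η , η>0 , y≥) =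
  -- δ and η are eventual lower bounds of the factors, so their product is one for the product.
  δ ℚ.* η
  , ℚ.positive⁻¹ (δ ℚ.* η) {{ℚ.pos*pos⇒pos δ {{ℚ.positive δ>0}} η {{ℚ.positive η>0}}}}
  , eventually-zipWith (λ n x≥δ y≥η → estimate (seq x n) (seq y n)
      (subst (ℚ._≤ seq x n) (ℚ.+-identityˡ δ) x≥δ)
      (subst (ℚ._≤ seq y n) (ℚ.+-identityˡ η) y≥η)) x≥ y≥
  where
  open ℚ.≤-Reasoning
  estimate : ∀ a b → δ ℚ.≤ a → η ℚ.≤ b → 0ℚ ℚ.+ δ ℚ.* η ℚ.≤ a ℚ.* b
  estimate a b δ≤a η≤b = begin
    0ℚ ℚ.+ δ ℚ.* η  ≡⟨ ℚ.+-identityˡ (δ ℚ.* η) ⟩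
    δ ℚ.* η         ≤⟨ ℚ.*-monoʳ-≤-nonNeg η {{ℚ.nonNegative (ℚ.<⇒≤ η>0)}} δ≤a ⟩
    a ℚ.* η         ≤⟨ ℚ.*-monoˡ-≤-nonNeg a
                         {{ℚ.nonNegative (ℚ.≤-trans (ℚ.<⇒≤ δ>0) δ≤a)}} η≤b ⟩
    a ℚ.* b         ∎

infixl 6 _-_

-- Negation is multiplication by the constant -1, so the Cauchy property comes from `_+_` and `_*_`.
_-_ : Op₂ ℝ
x - y = x + fromℚ (ℚ.- 1ℚ) * y

x≤y⇒0≤y-x : ∀ {x y} → x ≤ y → 0ℝ ≤ y - x
x≤y⇒0≤y-x {x} {y} x≤y ε ε>0 = eventually-map (λ n x≤ →
  subst₂ ℚ._≤_ (ℚ.+-inverseʳ (seq x n)) (shift (seq x n) (seq y n) ε)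
    (ℚ.+-monoˡ-≤ (ℚ.- seq x n) x≤)) (x≤y ε ε>0)
  where
  shift : ∀ p q ε → (q ℚ.+ ε) ℚ.- p ≡ (q ℚ.+ (ℚ.- 1ℚ) ℚ.* p) ℚ.+ ε
  shift = solve 3 (λ p q ε → (q :+ ε) :- p := (q :+ con (ℚ.- 1ℚ) :* p) :+ ε) refl

x<y⇒0<y-x : ∀ {x y} → x < y → 0ℝ < y - x
x<y⇒0<y-x {x} {y} (ε , ε>0 , x+ε≤y) = ε , ε>0 , eventually-map (λ n x+ε≤ →
  subst₂ ℚ._≤_ (cancel (seq x n) ε) (shift (seq x n) (seq y n))
    (ℚ.+-monoˡ-≤ (ℚ.- seq x n) x+ε≤)) x+ε≤y
  where
  cancel : ∀ p ε → (p ℚ.+ ε) ℚ.- p ≡ 0ℚ ℚ.+ ε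
  cancel = solve 2 (λ p ε → (p :+ ε) :- p := con 0ℚ :+ ε) refl
  shift : ∀ p q → q ℚ.- p ≡ q ℚ.+ (ℚ.- 1ℚ) ℚ.* p
  shift = solve 2 (λ p q → q :- p := q :+ con (ℚ.- 1ℚ) :* p) refl

-- By `*-nonneg` the product (y - x) z is nonnegative; adding x z term by term gives the claim.
*-monoʳ-≤-nonneg : ∀ {x y z} → 0ℝ ≤ z → x ≤ y → x * z ≤ y * z
*-monoʳ-≤-nonneg {x} {y} {z} 0≤z x≤y ε ε>0 = eventually-map (λ n 0≤ →
  subst₂ ℚ._≤_ (ℚ.+-identityˡ _) (shift (seq x n) (seq y n) (seq z n) ε)
    (ℚ.+-monoˡ-≤ (seq x n ℚ.* seq z n) 0≤))
  (*-nonneg {y - x} {z} (x≤y⇒0≤y-x {x} {y} x≤y) 0≤z ε ε>0)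
  where
  shift : ∀ p q r ε →
    ((q ℚ.+ (ℚ.- 1ℚ) ℚ.* p) ℚ.* r ℚ.+ ε) ℚ.+ p ℚ.* r ≡ q ℚ.* r ℚ.+ ε
  shift = solve 4 (λ p q r ε →
    ((q :+ con (ℚ.- 1ℚ) :* p) :* r :+ ε) :+ p :* r := q :* r :+ ε) refl

x≤1⇒x*y≤y : ∀ {x y} → 0ℝ ≤ y → x ≤ 1ℝ → x * y ≤ y
x≤1⇒x*y≤y {x} {y} 0≤y x≤1 =
  ≤-trans {x * y} {1ℝ * y} {y} (*-monoʳ-≤-nonneg {x} {1ℝ} {y} 0≤y x≤1)
    (≈⇒≤ {1ℝ * y} {y} (*-identityˡ y))

1≤x⇒y≤x*y : ∀ {x y} → 0ℝ ≤ y → 1ℝ ≤ x → y ≤ x * y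
1≤x⇒y≤x*y {x} {y} 0≤y 1≤x =
  ≤-trans {y} {1ℝ * y} {x * y} (≈⇒≤ {y} {1ℝ * y} (≈-sym {1ℝ * y} {y} (*-identityˡ y)))
    (*-monoʳ-≤-nonneg {1ℝ} {x} {y} 0≤y 1≤x)

1≤x⇒0<x : ∀ {x} → 1ℝ ≤ x → 0ℝ < x
1≤x⇒0<x {x} = <-≤-trans {0ℝ} {1ℝ} {x} 0<1

1≤x⇒0≤x : ∀ {x} → 1ℝ ≤ x → 0ℝ ≤ x
1≤x⇒0≤x {x} 1≤x = <⇒≤ {0ℝ} {x} (1≤x⇒0<x {x} 1≤x)

1≤x*y : ∀ {x y} → 1ℝ ≤ x → 1ℝ ≤ y → 1ℝ ≤ x * y
1≤x*y {x} {y} 1≤x 1≤y =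
  ≤-trans {1ℝ} {y} {x * y} 1≤y (1≤x⇒y≤x*y {x} {y} (1≤x⇒0≤x {y} 1≤y) 1≤x)

-- The gap comes from `y`, through 1 < y ≤ x y.
1<x*y : ∀ {x y} → 1ℝ < x → 1ℝ < y → 1ℝ < x * y
1<x*y {x} {y} 1<x 1<y =
  <-≤-trans {1ℝ} {y} {x * y} 1<y
    (1≤x⇒y≤x*y {x} {y} (1≤x⇒0≤x {y} (<⇒≤ {1ℝ} {y} 1<y)) (<⇒≤ {1ℝ} {x} 1<x))

-- Idempotents

-- Eventually z is at least δ, so dividing by z enlarges errors at most by the factor 1/δ. Hence the
-- hypothesis is taken at accuracy δ ε.
*-cancelˡ : ∀ {x y z} → 0ℝ < z → z * x ≈ z * y → x ≈ y
*-cancelˡ {x} {y} {z} (δ , δ>0 , z≥) zx≈zy ε ε>0 =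
  eventually-zipWith (λ n z≥δ → estimate (seq x n) (seq y n) (seq z n)
    (subst (ℚ._≤ seq z n) (ℚ.+-identityˡ δ) z≥δ)) z≥ (zx≈zy (δ ℚ.* ε) δε>0)
  where
  open ℚ.≤-Reasoning
  δε>0 : 0ℚ ℚ.< δ ℚ.* ε
  δε>0 = ℚ.positive⁻¹ (δ ℚ.* ε) {{ℚ.pos*pos⇒pos δ {{ℚ.positive δ>0}} ε {{ℚ.positive ε>0}}}}
  distrib : ∀ a b c → c ℚ.* (a ℚ.- b) ≡ c ℚ.* a ℚ.- c ℚ.* b
  distrib = solve 3 (λ a b c → c :* (a :- b) := c :* a :- c :* b) refl
  estimate : ∀ a b c → δ ℚ.≤ c → ∣ c ℚ.* a ℚ.- c ℚ.* b ∣ ℚ.< δ ℚ.* ε → ∣ a ℚ.- b ∣ ℚ.< ε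
  estimate a b c δ≤c close =
    ℚ.*-cancelˡ-<-nonNeg δ {{ℚ.nonNegative (ℚ.<⇒≤ δ>0)}} (begin-strict
      δ ℚ.* ∣ a ℚ.- b ∣         ≤⟨ ℚ.*-monoʳ-≤-nonNeg ∣ a ℚ.- b ∣ {{ℚ.∣-∣-nonNeg (a ℚ.- b)}}
                                     (ℚ.≤-trans δ≤c (p≤∣p∣ c)) ⟩
      ∣ c ∣ ℚ.* ∣ a ℚ.- b ∣     ≡⟨ sym (ℚ.∣p*q∣≡∣p∣*∣q∣ c (a ℚ.- b)) ⟩
      ∣ c ℚ.* (a ℚ.- b) ∣       ≡⟨ cong ∣_∣ (distrib a b c) ⟩
      ∣ c ℚ.* a ℚ.- c ℚ.* b ∣   <⟨ close ⟩
      δ ℚ.* ε                   ∎)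

-- The order on reals is not decidable, but that on rationals is: one term beyond the Cauchy index
-- for ¼ is compared with ½. Later terms differ from it by less than ¼, which leaves a gap of ¼ to 0
-- or to 1.
0<x⊎x<1 : ∀ x → 0ℝ < x ⊎ x < 1ℝ
0<x⊎x<1 x with cauchy x ¼ (ℚ.positive⁻¹ ¼)
  where ¼ = ½ ℚ.* ½
... | N , close = [ inj₁ ∘ positive , inj₂ ∘ below-one ]′ (ℚ.≤-total ½ (seq x N))
  where
  open ℚ.≤-Reasoning
  ¼ = ½ ℚ.* ½
  split : ∀ p q → p ≡ q ℚ.+ (p ℚ.- q)
  split = solve 2 (λ p q → p := q :+ (p :- q)) refl
  within : ∀ m n → N ℕ.≤ m → N ℕ.≤ n → seq x m ℚ.≤ seq x n ℚ.+ ¼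
  within m n N≤m N≤n = begin
    seq x m                               ≡⟨ split (seq x m) (seq x n) ⟩
    seq x n ℚ.+ (seq x m ℚ.- seq x n)     ≤⟨ ℚ.+-monoʳ-≤ (seq x n) (p≤∣p∣ _) ⟩
    seq x n ℚ.+ ∣ seq x m ℚ.- seq x n ∣   ≤⟨ ℚ.+-monoʳ-≤ (seq x n) (ℚ.<⇒≤ (close m n N≤m N≤n)) ⟩
    seq x n ℚ.+ ¼                         ∎
  positive : ½ ℚ.≤ seq x N → 0ℝ < x
  positive ½≤ = ¼ , ℚ.positive⁻¹ ¼ , N , λ n N≤n → begin
    0ℚ ℚ.+ ¼                   ≡⟨⟩
    ½ ℚ.- ¼                    ≤⟨ ℚ.+-monoˡ-≤ (ℚ.- ¼) (ℚ.≤-trans ½≤ (within N n ℕ.≤-refl N≤n)) ⟩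
    (seq x n ℚ.+ ¼) ℚ.- ¼      ≡⟨ solve 1 (λ p → (p :+ con ¼) :- con ¼ := p) refl (seq x n) ⟩
    seq x n                    ∎
  below-one : seq x N ℚ.≤ ½ → x < 1ℝ
  below-one ≤½ = ¼ , ℚ.positive⁻¹ ¼ , N , λ n N≤n → begin
    seq x n ℚ.+ ¼              ≤⟨ ℚ.+-monoˡ-≤ ¼ (within n N N≤n ℕ.≤-refl) ⟩
    (seq x N ℚ.+ ¼) ℚ.+ ¼      ≤⟨ ℚ.+-monoˡ-≤ ¼ (ℚ.+-monoˡ-≤ ¼ ≤½) ⟩
    (½ ℚ.+ ¼) ℚ.+ ¼            ≡⟨⟩
    1ℚ                         ∎

-- One of x and 1 - x is positive and can be cancelled: x from x x ≈ x 1, or 1 - x from (1 - x) x ≈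
-- (1 - x) 0.
idempotent⇒0⊎1 : ∀ {x} → x * x ≈ x → x ≈ 0ℝ ⊎ x ≈ 1ℝ
idempotent⇒0⊎1 {x} xx≈x = [ inj₂ ∘ positive , inj₁ ∘ below-one ]′ (0<x⊎x<1 x)
  where
  positive : 0ℝ < x → x ≈ 1ℝ
  positive 0<x = *-cancelˡ {x} {1ℝ} {x} 0<x (≈-trans {x * x} {x} {x * 1ℝ} xx≈x
    (≗⇒≈ {x} {x * 1ℝ} λ n → sym (ℚ.*-identityʳ (seq x n))))
  rearrange : ∀ p → ℚ.- (p ℚ.* p ℚ.- p) ≡
    (1ℚ ℚ.+ (ℚ.- 1ℚ) ℚ.* p) ℚ.* p ℚ.- (1ℚ ℚ.+ (ℚ.- 1ℚ) ℚ.* p) ℚ.* 0ℚ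
  rearrange = solve 1 (λ p → :- (p :* p :- p) :=
    (con 1ℚ :+ con (ℚ.- 1ℚ) :* p) :* p :- (con 1ℚ :+ con (ℚ.- 1ℚ) :* p) :* con 0ℚ) refl
  below-one : x < 1ℝ → x ≈ 0ℝ
  below-one x<1 = *-cancelˡ {x} {0ℝ} {1ℝ - x} (x<y⇒0<y-x {x} {1ℝ} x<1) λ ε ε>0 →
    -- (1 - p) p is the negative of p p - p, so both have the same absolute value.
    eventually-map (λ n → subst (ℚ._< ε)
      (trans (sym (ℚ.∣-p∣≡∣p∣ _)) (cong ∣_∣ (rearrange (seq x n))))) (xx≈x ε ε>0)

-- Prime factors counted with multiplicity

Ω : (n : ℕ) → .{{NonZero n}} → ℕ
Ω n = length (factors (factorise n))

-- Concatenates the two lists of primes; lengths add, which is what `Ω` measures.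
_*ᶠ_ : ∀ {m n} → PrimeFactorisation m → PrimeFactorisation n → PrimeFactorisation (m ℕ.* n)
f *ᶠ g = record
  { factors         = F.factors ++ G.factors
  ; isFactorisation = trans (cong₂ ℕ._*_ F.isFactorisation G.isFactorisation)
                            (sym (product-++ F.factors G.factors))
  ; factorsPrime    = ++⁺ F.factorsPrime G.factorsPrime
  }
  where
  module F = PrimeFactorisation f
  module G = PrimeFactorisation g

-- By unique factorisation, the prime factors of the product are a permutation of the concatenated
-- lists, and permutations preserve length.
Ω-homo-* : ∀ m n .{{_ : NonZero m}} .{{_ : NonZero n}} →
  Ω (m ℕ.* n) {{ℕ.m*n≢0 m n}} ≡ Ω m ℕ.+ Ω n
Ω-homo-* m n = trans
  (↭-length (factorisationUnique (factorise (m ℕ.* n) {{ℕ.m*n≢0 m n}}) (factorise m *ᶠ factorise n)))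
  (length-++ (factors (factorise m)))

Ω-nonZero : ∀ n .{{_ : NonZero n}} → 1 ℕ.< n → NonZero (Ω n)
Ω-nonZero n 1<n with factorise n
-- The empty product is 1, against 1 < n.
... | record { factors = [] ; isFactorisation = n≡1 } = contradiction (sym n≡1) (ℕ.<⇒≢ 1<n)
... | record { factors = _ ∷ _ } = _

-- Pointwise operations on arithmetic functions

module Pointwise {_∙_ : Op₂ ℝ} {e : ℝ} (isCM : IsCommutativeMonoid _≈_ _∙_ e) where

  open IsCommutativeMonoid isCM
    using (∙-cong; assoc; comm)

  commutativeMonoid : CommutativeMonoid 0ℓ 0ℓ
  commutativeMonoid = record { isCommutativeMonoid = isCM }

  open CommutativeMonoid commutativeMonoid using (commutativeSemigroup; monoid; identityˡ)
  open CommutativeSemigroupProperties commutativeSemigroup using (interchange)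
  open MonoidMult monoid using (×-homo-+) renaming (_×_ to _·_)

  infixl 7 _⊛_

  -- Unfolds to `_⊕_` when `_∙_` is addition and to `_⊙_` when it is multiplication, so both are
  -- treated at once.
  _⊛_ : Op₂ ArithFun
  (f ⊛ g) n = f n ∙ g n

  isSemigroupOn : ∀ {P} → Closed P _⊛_ → IsSemigroupOn P _⊛_
  isSemigroupOn closed = record
    { closed = λ {f} {g} → closed {f} {g}
    ; isSemigroup = record
      { isMagma = record
        { isEquivalence = record
          { refl  = λ {(f , _)} n → ≈-refl {f n}
          ; sym   = λ {(f , _)} {(g , _)} f≋g n → ≈-sym {f n} {g n} (f≋g n)
          ; trans = λ {(f , _)} {(g , _)} {(h , _)} f≋g g≋h n →
              ≈-trans {f n} {g n} {h n} (f≋g n) (g≋h n)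
          }
        ; ∙-cong = λ f≋g h≋k n → ∙-cong (f≋g n) (h≋k n)
        }
      ; assoc = λ (f , _) (g , _) (h , _) n → assoc (f n) (g n) (h n)
      }
    }

  -- The identity `ι` is a parameter that acts as such only on `P`: for products on `𝒢` it differs
  -- from the constant function `unit`.
  isCommutativeMonoidOn : ∀ {P} → Closed P _⊛_ → (ι : ArithFun) → ι ∈ P →
    (∀ {f} → f ∈ P → ι ⊛ f ≋ f) → IsCommutativeMonoidOn P _⊛_
  isCommutativeMonoidOn closed ι ι∈P ι-identityˡ = record
    { closed = λ {f} {g} → closed {f} {g}
    ; ε = ι , ι∈P
    ; isCommutativeMonoid = record
      { isMonoid = record
        { isSemigroup = IsSemigroupOn.isSemigroup (isSemigroupOn closed)
        ; identity = (λ (f , f∈P) → ι-identityˡ {f} f∈P)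
                   , (λ (f , f∈P) n → ≈-trans {f n ∙ ι n} {ι n ∙ f n} {f n}
                       (comm (f n) (ι n)) (ι-identityˡ {f} f∈P n))
        }
      ; comm = λ (f , _) (g , _) n → comm (f n) (g n)
      }
    }

  unit : ArithFun
  unit _ = e

  unit-identityˡ : ∀ f → unit ⊛ f ≋ f
  unit-identityˡ f n = identityˡ (f n)

  -- For addition this is `Additive`; for multiplication it is the second component of
  -- `Multiplicative`.
  Homomorphic : Pred ArithFun 0ℓ
  Homomorphic f = ∀ x y .{{_ : NonZero x}} .{{_ : NonZero y}} → Coprime x y →
    f (x ℕ.* y) {{ℕ.m*n≢0 x y}} ≈ f x ∙ f y

  unit-homomorphic : Homomorphic unit
  unit-homomorphic x y _ = ≈-sym {e ∙ e} {e} (identityˡ e)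

  ⊛-homomorphic : Closed Homomorphic _⊛_
  ⊛-homomorphic {f} {g} hom-f hom-g x y x⊥y = begin
    f xy ∙ g xy                    ≈⟨ ∙-cong (hom-f x y x⊥y) (hom-g x y x⊥y) ⟩
    (f x ∙ f y) ∙ (g x ∙ g y)      ≈⟨ interchange (f x) (f y) (g x) (g y) ⟩
    (f x ∙ g x) ∙ (f y ∙ g y)      ∎
    where
    open SetoidReasoning ≈-setoid
    xy = x ℕ.* y
    instance _ = ℕ.m*n≢0 x y

  ⊛-forAll>1 : ∀ (P : Pred ℝ 0ℓ) → (∀ {r s} → P r → P s → P (r ∙ s)) →
    Closed (ForAll>1 P) _⊛_
  ⊛-forAll>1 P ∙-closed Pf Pg n 1<n = ∙-closed (Pf n 1<n) (Pg n 1<n)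

  -- For addition this is n ↦ c Ω(n), for multiplication n ↦ c^Ω(n).
  Ω-multiple : ℝ → ArithFun
  Ω-multiple c n = Ω n · c

  -- `Ω` turns products into sums, and k ↦ k · c turns sums into `_∙_`.
  Ω-multiple-homomorphic : ∀ c → Homomorphic (Ω-multiple c)
  Ω-multiple-homomorphic c x y _ = begin
    Ω (x ℕ.* y) · c        ≡⟨ cong (_· c) (Ω-homo-* x y) ⟩
    (Ω x ℕ.+ Ω y) · c      ≈⟨ ×-homo-+ c (Ω x) (Ω y) ⟩
    (Ω x · c) ∙ (Ω y · c)  ∎
    where
    open SetoidReasoning ≈-setoid
    instance _ = ℕ.m*n≢0 x y

  -- The induction starts at one copy of c, because strict conditions such as 0 < r for sums or 1 <
  -- r for products fail at the unit `e`.
  ·-closed : ∀ (P : Pred ℝ 0ℓ) → (∀ {r s} → P r → P s → P (r ∙ s)) →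
    ∀ {c} → P c → ∀ k .{{_ : NonZero k}} → P (k · c)
  ·-closed P ∙-closed Pc 1             = Pc
  ·-closed P ∙-closed Pc (suc (suc k)) = ∙-closed (·-closed P ∙-closed Pc (suc k)) Pc

  Ω-multiple-forAll>1 : ∀ (P : Pred ℝ 0ℓ) → (∀ {r s} → P r → P s → P (r ∙ s)) →
    ∀ {c} → P c → ForAll>1 P (Ω-multiple c)
  Ω-multiple-forAll>1 P ∙-closed Pc n 1<n =
    ·-closed P ∙-closed Pc (Ω n) {{Ω-nonZero n 1<n}}

module Sum = Pointwise +-0-isCommutativeMonoid
module Product = Pointwise *-1-isCommutativeMonoid

-- Multiplicative functions: value at 1 and nonvanishing.

forAll>1-map : ∀ (P Q : Pred ℝ 0ℓ) → (∀ {r} → P r → Q r) → ForAll>1 P ⊆ ForAll>1 Q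
forAll>1-map P Q P⊆Q Pf n 1<n = P⊆Q (Pf n 1<n)

-- Replacing a number by an equal one changes the type of its positivity proof; irrelevance of the
-- proofs makes the values agree.
arith-cong : ∀ (f : ArithFun) {m n} .(p : NonZero m) .(q : NonZero n) → m ≡ n →
  f m {{p}} ≈ f n {{q}}
arith-cong f {m} p q refl = ≈-refl {f m {{p}}}

multiplicative-1 : ∀ {g} → Multiplicative g → g 1 ≈ 1ℝ
multiplicative-1 {g} (g≉0 , hom) =
  [ (λ g1≈0 → contradiction (vanishes g1≈0) g≉0) , id ]′
    -- As 1 is coprime to itself and 1 · 1 reduces to 1, multiplicativity at the pair (1, 1) says
    -- that g(1) is idempotent.
    (idempotent⇒0⊎1 {g 1} (≈-sym {g 1} {g 1 * g 1} (hom 1 1 (1-coprimeTo 1))))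
  where
  open SetoidReasoning ≈-setoid
  vanishes : g 1 ≈ 0ℝ → ∀ x .{{_ : NonZero x}} → g x ≈ 0ℝ
  vanishes g1≈0 x = begin
    g x                          ≈⟨ arith-cong g _ (ℕ.m*n≢0 1 x) (sym (ℕ.*-identityˡ x)) ⟩
    g (1 ℕ.* x) {{ℕ.m*n≢0 1 x}}  ≈⟨ hom 1 x (1-coprimeTo x) ⟩
    g 1 * g x                    ≈⟨ *-cong {g 1} {0ℝ} {g x} {g x} g1≈0 (≈-refl {g x}) ⟩
    0ℝ * g x                     ≈⟨ *-zeroˡ (g x) ⟩
    0ℝ                           ∎

-- The product takes the value 1 · 1 ≈ 1 at 1, so it does not vanish identically.
⊙-multiplicative : Closed Multiplicative _⊙_
⊙-multiplicative {f} {g} mult-f mult-g =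
  (λ fg≈0 → 0<x⇒x≉0 {1ℝ} 0<1 (begin
    1ℝ          ≈⟨ *-identityˡ 1ℝ ⟨
    1ℝ * 1ℝ     ≈⟨ *-cong {f 1} {1ℝ} {g 1} {1ℝ} (multiplicative-1 {f} mult-f)
                     (multiplicative-1 {g} mult-g) ⟨
    f 1 * g 1   ≈⟨ fg≈0 1 ⟩
    0ℝ          ∎))
  , Product.⊛-homomorphic {f} {g} (proj₂ mult-f) (proj₂ mult-g)
  where open SetoidReasoning ≈-setoid

positive⇒nonvanishing : ∀ {g} → ForAll>1 (0ℝ <_) g → ¬ (∀ x .{{_ : NonZero x}} → g x ≈ 0ℝ)
-- Evaluated at 2, where `ℕ.≤-refl` proves 1 < 2 in the form 2 ≤ 2.
positive⇒nonvanishing {g} g>0 g≈0 = 0<x⇒x≉0 {g 2} (g>0 2 ℕ.≤-refl) (g≈0 2)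

-- Products in the unit interval.

0≤r≤1 0<r≤1 0<r<1 : Pred ℝ 0ℓ
0≤r≤1 r = 0ℝ ≤ r × r ≤ 1ℝ
0<r≤1 r = 0ℝ < r × r ≤ 1ℝ
0<r<1 r = 0ℝ < r × r < 1ℝ

x*y≤1 : ∀ {x y} → x ≤ 1ℝ → 0≤r≤1 y → x * y ≤ 1ℝ
x*y≤1 {x} {y} x≤1 (0≤y , y≤1) =
  ≤-trans {x * y} {y} {1ℝ} (x≤1⇒x*y≤y {x} {y} 0≤y x≤1) y≤1

0≤r≤1-*-closed : ∀ {x y} → 0≤r≤1 x → 0≤r≤1 y → 0≤r≤1 (x * y)
0≤r≤1-*-closed {x} {y} (0≤x , x≤1) (0≤y , y≤1) =
  *-nonneg {x} {y} 0≤x 0≤y , x*y≤1 {x} {y} x≤1 (0≤y , y≤1)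

0<r≤1-*-closed : ∀ {x y} → 0<r≤1 x → 0<r≤1 y → 0<r≤1 (x * y)
0<r≤1-*-closed {x} {y} (0<x , x≤1) (0<y , y≤1) =
  *-pos {x} {y} 0<x 0<y , x*y≤1 {x} {y} x≤1 (<⇒≤ {0ℝ} {y} 0<y , y≤1)

0<r<1-*-closed : ∀ {x y} → 0<r<1 x → 0<r<1 y → 0<r<1 (x * y)
0<r<1-*-closed {x} {y} (0<x , x<1) (0<y , y<1) =
  *-pos {x} {y} 0<x 0<y
  , ≤-<-trans {x * y} {y} {1ℝ}
      (x≤1⇒x*y≤y {x} {y} (<⇒≤ {0ℝ} {y} 0<y) (<⇒≤ {x} {1ℝ} x<1)) y<1

0≤1 : 0ℝ ≤ 1ℝ
0≤1 = <⇒≤ {0ℝ} {1ℝ} 0<1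

1-multiplicative : Multiplicative Product.unit
1-multiplicative =
  positive⇒nonvanishing {Product.unit} (λ _ _ → 0<1) , Product.unit-homomorphic

-- The identity for products of functions that vanish at 1.

isNot1 : ArithFun
isNot1 1 = 0ℝ
isNot1 _ = 1ℝ

isNot1-identityˡ : ∀ {f} → f 1 ≈ 0ℝ → isNot1 ⊙ f ≋ f
isNot1-identityˡ {f} f1≈0 1 =
  ≈-trans {0ℝ * f 1} {0ℝ} {f 1} (*-zeroˡ (f 1)) (≈-sym {f 1} {0ℝ} f1≈0)
isNot1-identityˡ {f} f1≈0 n@(suc (suc _)) = *-identityˡ (f n)

isNot1∈𝒢₀ : isNot1 ∈ 𝒢₀
isNot1∈𝒢₀ = (≈-refl {0ℝ} , forAll>1-map (0ℝ <_) (0ℝ ≤_) (λ {r} → <⇒≤ {0ℝ} {r}) {isNot1} pos) , pos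
  where
  pos : ForAll>1 (0ℝ <_) isNot1
  pos 1             1<1 = contradiction 1<1 (ℕ.<-irrefl refl)
  pos (suc (suc _)) _   = 0<1

-- Closure of the classes under the operations.

𝒢-⊕-closed : Closed 𝒢 _⊕_
𝒢-⊕-closed {f} {g} (f1≈0 , f≥0) (g1≈0 , g≥0) =
  ≈-trans {f 1 + g 1} {0ℝ + 0ℝ} {0ℝ} (+-cong {f 1} {0ℝ} {g 1} {0ℝ} f1≈0 g1≈0)
    (Sum.unit-identityˡ Sum.unit 1)
  , Sum.⊛-forAll>1 (0ℝ ≤_) (λ {r} {s} → +-nonneg {r} {s}) {f} {g} f≥0 g≥0

𝒢-⊙-closed : Closed 𝒢 _⊙_
𝒢-⊙-closed {f} {g} (f1≈0 , f≥0) (g1≈0 , g≥0) =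
  ≈-trans {f 1 * g 1} {0ℝ * g 1} {0ℝ}
    (*-cong {f 1} {0ℝ} {g 1} {g 1} f1≈0 (≈-refl {g 1})) (*-zeroˡ (g 1))
  , Product.⊛-forAll>1 (0ℝ ≤_) (λ {r} {s} → *-nonneg {r} {s}) {f} {g} f≥0 g≥0

𝒢₀-⊕-closed : Closed 𝒢₀ _⊕_
𝒢₀-⊕-closed {f} {g} (f∈𝒢 , f>0) (g∈𝒢 , g>0) =
  𝒢-⊕-closed {f} {g} f∈𝒢 g∈𝒢
  , Sum.⊛-forAll>1 (0ℝ <_) (λ {r} {s} → +-pos {r} {s}) {f} {g} f>0 g>0

𝒢₀-⊙-closed : Closed 𝒢₀ _⊙_
𝒢₀-⊙-closed {f} {g} (f∈𝒢 , f>0) (g∈𝒢 , g>0) =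
  𝒢-⊙-closed {f} {g} f∈𝒢 g∈𝒢
  , Product.⊛-forAll>1 (0ℝ <_) (λ {r} {s} → *-pos {r} {s}) {f} {g} f>0 g>0

𝒜-⊕-closed : Closed 𝒜 _⊕_
𝒜-⊕-closed {f} {g} (add-f , f≥0) (add-g , g≥0) =
  Sum.⊛-homomorphic {f} {g} add-f add-g
  , Sum.⊛-forAll>1 (0ℝ ≤_) (λ {r} {s} → +-nonneg {r} {s}) {f} {g} f≥0 g≥0

𝒜₀-⊕-closed : Closed 𝒜₀ _⊕_
𝒜₀-⊕-closed {f} {g} (f∈𝒜 , f>0) (g∈𝒜 , g>0) =
  𝒜-⊕-closed {f} {g} f∈𝒜 g∈𝒜
  , Sum.⊛-forAll>1 (0ℝ <_) (λ {r} {s} → +-pos {r} {s}) {f} {g} f>0 g>0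

ℳ-⊙-closed : Closed ℳ _⊙_
ℳ-⊙-closed {f} {g} (mult-f , f≥1) (mult-g , g≥1) =
  ⊙-multiplicative {f} {g} mult-f mult-g
  , Product.⊛-forAll>1 (1ℝ ≤_) (λ {r} {s} → 1≤x*y {r} {s}) {f} {g} f≥1 g≥1

ℳ₁-⊙-closed : Closed ℳ₁ _⊙_
ℳ₁-⊙-closed {f} {g} (f∈ℳ , f>1) (g∈ℳ , g>1) =
  ℳ-⊙-closed {f} {g} f∈ℳ g∈ℳ
  , Product.⊛-forAll>1 (1ℝ <_) (λ {r} {s} → 1<x*y {r} {s}) {f} {g} f>1 g>1

ℐ-⊙-closed : Closed ℐ _⊙_
ℐ-⊙-closed {f} {g} (mult-f , f∈[0,1]) (mult-g , g∈[0,1]) =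
  ⊙-multiplicative {f} {g} mult-f mult-g
  , Product.⊛-forAll>1 0≤r≤1 (λ {r} {s} → 0≤r≤1-*-closed {r} {s}) {f} {g} f∈[0,1] g∈[0,1]

ℐ₀-⊙-closed : Closed ℐ₀ _⊙_
ℐ₀-⊙-closed {f} {g} (f∈ℐ , f∈]0,1]) (g∈ℐ , g∈]0,1]) =
  ℐ-⊙-closed {f} {g} f∈ℐ g∈ℐ
  , Product.⊛-forAll>1 0<r≤1 (λ {r} {s} → 0<r≤1-*-closed {r} {s}) {f} {g} f∈]0,1] g∈]0,1]

ℐ₀₁-⊙-closed : Closed ℐ₀₁ _⊙_
ℐ₀₁-⊙-closed {f} {g} (f∈ℐ , f∈]0,1[) (g∈ℐ , g∈]0,1[) =
  ℐ-⊙-closed {f} {g} f∈ℐ g∈ℐ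
  , Product.⊛-forAll>1 0<r<1 (λ {r} {s} → 0<r<1-*-closed {r} {s}) {f} {g} f∈]0,1[ g∈]0,1[

-- Both sets are carved out of `ℐ`, so this inclusion is not a projection: r < 1 is weakened to r ≤
-- 1.
ℐ₀₁⊆ℐ₀ : ℐ₀₁ ⊆ ℐ₀
ℐ₀₁⊆ℐ₀ {h} (h∈ℐ , h∈]0,1[) =
  h∈ℐ
  , forAll>1-map 0<r<1 0<r≤1 (λ {r} (0<r , r<1) → 0<r , <⇒≤ {r} {1ℝ} r<1) {h} h∈]0,1[

-- Elements of the subsemigroups.

Ω∈𝒜₀ : Sum.Ω-multiple 1ℝ ∈ 𝒜₀
Ω∈𝒜₀ =
  ( Sum.Ω-multiple-homomorphic 1ℝ
  , forAll>1-map (0ℝ <_) (0ℝ ≤_) (λ {r} → <⇒≤ {0ℝ} {r}) {Sum.Ω-multiple 1ℝ} pos )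
  , pos
  where
  pos : ForAll>1 (0ℝ <_) (Sum.Ω-multiple 1ℝ)
  pos = Sum.Ω-multiple-forAll>1 (0ℝ <_) (λ {r} {s} → +-pos {r} {s}) {1ℝ} 0<1

2^Ω ½^Ω : ArithFun
2^Ω = Product.Ω-multiple (fromℚ (1ℚ ℚ.+ 1ℚ))
½^Ω = Product.Ω-multiple (fromℚ ½)

2^Ω∈ℳ₁ : 2^Ω ∈ ℳ₁
2^Ω∈ℳ₁ =
  ( ( positive⇒nonvanishing {2^Ω}
        (forAll>1-map (1ℝ ≤_) (0ℝ <_) (λ {r} → 1≤x⇒0<x {r}) {2^Ω} ≥1)
    , Product.Ω-multiple-homomorphic _ )
  , ≥1 )
  , >1
  where
  >1 : ForAll>1 (1ℝ <_) 2^Ω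
  >1 = Product.Ω-multiple-forAll>1 (1ℝ <_) (λ {r} {s} → 1<x*y {r} {s})
    {fromℚ (1ℚ ℚ.+ 1ℚ)} (fromℚ-mono-< (ℚ.+-monoʳ-< 1ℚ (ℚ.positive⁻¹ 1ℚ)))
  ≥1 : ForAll>1 (1ℝ ≤_) 2^Ω
  ≥1 = forAll>1-map (1ℝ <_) (1ℝ ≤_) (λ {r} → <⇒≤ {1ℝ} {r}) {2^Ω} >1

½^Ω∈ℐ₀₁ : ½^Ω ∈ ℐ₀₁
½^Ω∈ℐ₀₁ =
  ( ( positive⇒nonvanishing {½^Ω} (forAll>1-map 0<r<1 (0ℝ <_) proj₁ {½^Ω} ∈]0,1[)
    , Product.Ω-multiple-homomorphic _ )
  , forAll>1-map 0<r<1 0≤r≤1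
      (λ {r} (0<r , r<1) → <⇒≤ {0ℝ} {r} 0<r , <⇒≤ {r} {1ℝ} r<1) {½^Ω} ∈]0,1[ )
  , ∈]0,1[
  where
  ∈]0,1[ : ForAll>1 0<r<1 ½^Ω
  ∈]0,1[ = Product.Ω-multiple-forAll>1 0<r<1 (λ {r} {s} → 0<r<1-*-closed {r} {s})
    -- The bound ½ < 1 arises by adding ½ to both sides of 0 < ½.
    {fromℚ ½} (fromℚ-mono-< (ℚ.positive⁻¹ ½) , fromℚ-mono-< (ℚ.+-monoʳ-< ½ (ℚ.positive⁻¹ ½)))

lemma3p4 : ( IsCommutativeMonoidOn 𝒢 _⊕_
    × IsCommutativeMonoidOn 𝒢 _⊙_
    × IsCommutativeMonoidOn 𝒢₀ _⊙_
    × IsCommutativeMonoidOn 𝒜 _⊕_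
    × IsCommutativeMonoidOn ℳ _⊙_
    × IsCommutativeMonoidOn ℐ _⊙_
    × IsCommutativeMonoidOn ℐ₀ _⊙_ )
    × ( IsSubsemigroupOf 𝒢₀ 𝒢 _⊕_
    × IsSubsemigroupOf 𝒜₀ 𝒜 _⊕_
    × IsSubsemigroupOf ℳ₁ ℳ _⊙_
    × IsSubsemigroupOf ℐ₀₁ ℐ _⊙_
    × IsSubsemigroupOf ℐ₀₁ ℐ₀ _⊙_ )
lemma3p4 =
  ( Sum.isCommutativeMonoidOn (λ {f} {g} → 𝒢-⊕-closed {f} {g}) Sum.unit
      (≈-refl {0ℝ} , λ _ _ → ≈⇒≤ {0ℝ} {0ℝ} (≈-refl {0ℝ})) (λ {f} _ → Sum.unit-identityˡ f)
  , Product.isCommutativeMonoidOn (λ {f} {g} → 𝒢-⊙-closed {f} {g}) isNot1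
      (proj₁ isNot1∈𝒢₀) (λ {f} (f1≈0 , _) → isNot1-identityˡ {f} f1≈0)
  , Product.isCommutativeMonoidOn (λ {f} {g} → 𝒢₀-⊙-closed {f} {g}) isNot1
      isNot1∈𝒢₀ (λ {f} ((f1≈0 , _) , _) → isNot1-identityˡ {f} f1≈0)
  , Sum.isCommutativeMonoidOn (λ {f} {g} → 𝒜-⊕-closed {f} {g}) Sum.unit
      (Sum.unit-homomorphic , λ _ _ → ≈⇒≤ {0ℝ} {0ℝ} (≈-refl {0ℝ}))
      (λ {f} _ → Sum.unit-identityˡ f)
  , Product.isCommutativeMonoidOn (λ {f} {g} → ℳ-⊙-closed {f} {g}) Product.unit
      (1-multiplicative , λ _ _ → 1≤1) (λ {f} _ → Product.unit-identityˡ f)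
  , Product.isCommutativeMonoidOn (λ {f} {g} → ℐ-⊙-closed {f} {g}) Product.unit
      1∈ℐ (λ {f} _ → Product.unit-identityˡ f)
  , ℐ₀-isCommutativeMonoidOn )
  , ( record
      { ambient  = Sum.isSemigroupOn (λ {f} {g} → 𝒢-⊕-closed {f} {g})
      ; included = proj₁
      -- The identity for products also serves as an element here, where the operation is the sum.
      ; nonempty = isNot1 , isNot1∈𝒢₀
      ; closed   = λ {f} {g} → 𝒢₀-⊕-closed {f} {g}
      }
    , record
      { ambient  = Sum.isSemigroupOn (λ {f} {g} → 𝒜-⊕-closed {f} {g})
      ; included = proj₁
      ; nonempty = Sum.Ω-multiple 1ℝ , Ω∈𝒜₀
      ; closed   = λ {f} {g} → 𝒜₀-⊕-closed {f} {g}
      }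
    , record
      { ambient  = Product.isSemigroupOn (λ {f} {g} → ℳ-⊙-closed {f} {g})
      ; included = proj₁
      ; nonempty = 2^Ω , 2^Ω∈ℳ₁
      ; closed   = λ {f} {g} → ℳ₁-⊙-closed {f} {g}
      }
    , record
      { ambient  = Product.isSemigroupOn (λ {f} {g} → ℐ-⊙-closed {f} {g})
      ; included = proj₁
      ; nonempty = ½^Ω , ½^Ω∈ℐ₀₁
      ; closed   = λ {f} {g} → ℐ₀₁-⊙-closed {f} {g}
      }
    , record
      { ambient  = Product.isSemigroupOn (λ {f} {g} → ℐ₀-⊙-closed {f} {g})
      ; included = λ {h} → ℐ₀₁⊆ℐ₀ {h}
      ; nonempty = ½^Ω , ½^Ω∈ℐ₀₁
      ; closed   = λ {f} {g} → ℐ₀₁-⊙-closed {f} {g}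
      } )
  where
  1≤1 : 1ℝ ≤ 1ℝ
  1≤1 = ≈⇒≤ {1ℝ} {1ℝ} (≈-refl {1ℝ})
  1∈ℐ : Product.unit ∈ ℐ
  1∈ℐ = 1-multiplicative , λ _ _ → 0≤1 , 1≤1
  ℐ₀-isCommutativeMonoidOn : IsCommutativeMonoidOn ℐ₀ _⊙_
  ℐ₀-isCommutativeMonoidOn =
    Product.isCommutativeMonoidOn (λ {f} {g} → ℐ₀-⊙-closed {f} {g}) Product.unit
      (1∈ℐ , λ _ _ → 0<1 , 1≤1) (λ {f} _ → Product.unit-identityˡ f)
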